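{- For all $P,Q\in C_A$, $\mathrm{CP}_{cr}(A)\vdash P=Q$ if and only if $P=_{cse}Q$, i.e. if and only if $cse(P)=cse(Q)$.
   Context: Let $A$ be a countable set (of atoms) with at least two elements. $C_A$ is the set of closed terms (conditional statements) over the signature with constants $T$, $F$, a constant $a$ for each $a\in A$, and one ternary operation $x\triangleleft y\triangleright z$ (the conditional, "if $y$ then $x$ else $z$"). $\mathrm{CP}$ is the set of equational axioms (in variables $x,y,z,u,v$): (CP1) $x\triangleleft T\triangleright y=x$; (CP2) $x\triangleleft F\triangleright y=y$; (CP3) $T\triangleleft x\triangleright F=x$; (CP4) $x\triangleleft(y\triangleleft z\triangleright u)\triangleright v=(x\triangleleft y\triangleright v)\triangleleft z\triangleright(x\triangleleft u\triangleright v)$. $\mathrm{CP}_{cr}(A)$ is $\mathrm{CP}$ extended with, for every $a\in A$, the axioms (CPcr1) $(x\triangleleft a\triangleright y)\triangleleft a\triangleright z=x\triangleleft a\triangleright z$; (CPcr2) $x\triangleleft a\triangleright(y\triangleleft a\triangleright z)=x\triangleleft a\triangleright z$. For a set $E$ of equational axioms, $E\vdash s=t$ means derivability in equational logic from $E$. Evaluation trees: the set $\mathcal T_A$ is defined inductively by $T\in\mathcal T_A$, $F\in\mathcal T_A$, and $(X\trianglelefteq a\trianglerighteq Y)\in\mathcal T_A$ for all $X,Y\in\mathcal T_A$, $a\in A$ (binary tree with root $a$, left branch $X$, right branch $Y$). Leaf replacement: for $Y,Z\in\mathcal T_A$, $X[T\mapsto Y,F\mapsto Z]$ is defined by $T[T\mapsto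 Y,F\mapsto Z]=Y$, $F[T\mapsto Y,F\mapsto Z]=Z$, $(X_1\trianglelefteq a\trianglerighteq X_2)[T\mapsto Y,F\mapsto Z]=X_1[T\mapsto Y,F\mapsto Z]\trianglelefteq a\trianglerighteq X_2[T\mapsto Y,F\mapsto Z]$. The short-circuit evaluation function $se:C_A\to\mathcal T_A$ is defined by $se(T)=T$, $se(F)=F$, $se(a)=T\trianglelefteq a\trianglerighteq F$ for $a\in A$, and $se(P\triangleleft Q\triangleright R)=se(Q)[T\mapsto se(P),F\mapsto se(R)]$. Contractive evaluation trees: for $a\in A$ define $H_a,J_a:\mathcal T_A\to\mathcal T_A$ by $H_a(B)=J_a(B)=B$ for $B\in\{T,F\}$; $H_a(X\trianglelefteq a\trianglerighteq Y)=H_a(X)$; $J_a(X\trianglelefteq a\trianglerighteq Y)=J_a(Y)$; and $H_a(X\trianglelefteq b\trianglerighteq Y)=J_a(X\trianglelefteq b\trianglerighteq Y)=X\trianglelefteq b\trianglerighteq Y$ if $b\neq a$. Define $cr:\mathcal T_A\to\mathcal T_A$ (by recursion on depth) by $cr(T)=T$, $cr(F)=F$, $cr(X\trianglelefteq a\trianglerighteq Y)=cr(H_a(X))\trianglelefteq a\trianglerighteq cr(J_a(Y))$. Then $cse:C_A\to\mathcal T_A$ is $cse(P)=cr(se(P))$, and contractive valuation congruence is: $P=_{cse}Q$ iff $cse(P)=cse(Q)$. -}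

module Defs where

open import Data.Empty using (⊥)
open import Data.Nat using (ℕ; suc; _≤_; _<_; _⊔_; s≤s)
import Data.Nat.Properties as ℕ
open import Data.Nat.Induction using (<-wellFounded)
open import Function.Bundles using (_↣_)
open import Induction.WellFounded using (Acc; acc)
open import Level using (Level)
open import Relation.Binary.Core using (Rel)
open import Relation.Binary.Definitions using (DecidableEquality)
open import Relation.Binary.PropositionalEquality using (_≡_; refl; cong₂)
open import Relation.Nullary using (yes; no)
open import Relation.Nullary.Decidable using (via-injection)

private
  variable
    ℓ : Level
    A : Set ℓ

infix 8 _◁_▷_ _⊴_⊵_
infix 4 _⊢_≈_

-- x ◁ y ▷ z reads "if y then x else z".
data Term (A : Set ℓ) (V : Set) : Set ℓ where
  var   : V → Term A V
  T F   : Term A V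
  atom  : A → Term A V
  _◁_▷_ : Term A V → Term A V → Term A V → Term A V

C : Set ℓ → Set ℓ
C A = Term A ⊥

Var : Set
Var = ℕ

sub : {V W : Set} → (V → Term A W) → Term A V → Term A W
sub σ (var x)     = σ x
sub σ T           = T
sub σ F           = F
sub σ (atom a)    = atom a
sub σ (s ◁ t ▷ r) = sub σ s ◁ sub σ t ▷ sub σ r

-- A closed term, viewed as an open term in which no variable occurs.
⌜_⌝ : C A → Term A Var
⌜_⌝ = sub (λ ())

-- A set E of equations between open terms is a binary relation on them.
data _⊢_≈_ {A : Set ℓ} (E : Rel (Term A Var) ℓ) : Rel (Term A Var) ℓ where
  axiom        : ∀ {s t} → E s t → E ⊢ s ≈ t
  reflexivity  : ∀ {t} → E ⊢ t ≈ t
  symmetry     : ∀ {s t} → E ⊢ s ≈ t → E ⊢ t ≈ s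
  transitivity : ∀ {s t r} → E ⊢ s ≈ t → E ⊢ t ≈ r → E ⊢ s ≈ r
  congruence   : ∀ {s s′ t t′ r r′} →
                 E ⊢ s ≈ s′ → E ⊢ t ≈ t′ → E ⊢ r ≈ r′ →
                 E ⊢ s ◁ t ▷ r ≈ s′ ◁ t′ ▷ r′
  substitution : ∀ {s t} (σ : Var → Term A Var) →
                 E ⊢ s ≈ t → E ⊢ sub σ s ≈ sub σ t

module _ {A : Set ℓ} where

  private
    x y z u v : Term A Var
    x = var 0
    y = var 1
    z = var 2
    u = var 3
    v = var 4

  data CP : Rel (Term A Var) ℓ where
    CP1 : CP (x ◁ T ▷ y) x
    CP2 : CP (x ◁ F ▷ y) y
    CP3 : CP (T ◁ x ▷ F) x
    CP4 : CP (x ◁ (y ◁ z ▷ u) ▷ v) ((x ◁ y ▷ v) ◁ z ▷ (x ◁ u ▷ v))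

  data CPcr : Rel (Term A Var) ℓ where
    cp    : ∀ {s t} → CP s t → CPcr s t
    CPcr1 : ∀ a → CPcr ((x ◁ atom a ▷ y) ◁ atom a ▷ z) (x ◁ atom a ▷ z)
    CPcr2 : ∀ a → CPcr (x ◁ atom a ▷ (y ◁ atom a ▷ z)) (x ◁ atom a ▷ z)

data Tree (A : Set ℓ) : Set ℓ where
  T F   : Tree A
  _⊴_⊵_ : Tree A → A → Tree A → Tree A

_[T↦_,F↦_] : Tree A → Tree A → Tree A → Tree A
T             [T↦ Y ,F↦ Z ] = Y
F             [T↦ Y ,F↦ Z ] = Z
(X₁ ⊴ a ⊵ X₂) [T↦ Y ,F↦ Z ] = (X₁ [T↦ Y ,F↦ Z ]) ⊴ a ⊵ (X₂ [T↦ Y ,F↦ Z ])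

se : C A → Tree A
se T           = T
se F           = F
se (atom a)    = T ⊴ a ⊵ F
se (P ◁ Q ▷ R) = se Q [T↦ se P ,F↦ se R ]

depth : Tree A → ℕ
depth T           = 0
depth F           = 0
depth (X ⊴ a ⊵ Y) = suc (depth X ⊔ depth Y)

-- The case distinction in H and J needs decidable equality of atoms; it is
-- obtained from countability, given as an injection into ℕ (so A may be finite).
module Contractive {A : Set ℓ} (A↣ℕ : A ↣ ℕ) where

  _≟_ : DecidableEquality A
  _≟_ = via-injection A↣ℕ ℕ._≟_

  H : A → Tree A → Tree A
  H a T = T
  H a F = F
  H a (X ⊴ b ⊵ Y) with b ≟ a
  ... | yes _ = H a X
  ... | no  _ = X ⊴ b ⊵ Y

  J : A → Tree A → Tree A
  J a T = T
  J a F = F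
  J a (X ⊴ b ⊵ Y) with b ≟ a
  ... | yes _ = J a Y
  ... | no  _ = X ⊴ b ⊵ Y

  depth-H : ∀ a X → depth (H a X) ≤ depth X
  depth-H a T = ℕ.≤-refl
  depth-H a F = ℕ.≤-refl
  depth-H a (X ⊴ b ⊵ Y) with b ≟ a
  ... | yes _ = ℕ.m≤n⇒m≤1+n (ℕ.≤-trans (depth-H a X) (ℕ.m≤m⊔n (depth X) (depth Y)))
  ... | no  _ = ℕ.≤-refl

  depth-J : ∀ a X → depth (J a X) ≤ depth X
  depth-J a T = ℕ.≤-refl
  depth-J a F = ℕ.≤-refl
  depth-J a (X ⊴ b ⊵ Y) with b ≟ a
  ... | yes _ = ℕ.m≤n⇒m≤1+n (ℕ.≤-trans (depth-J a Y) (ℕ.m≤n⊔m (depth X) (depth Y)))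
  ... | no  _ = ℕ.≤-refl

  depth-H< : ∀ X a Y → depth (H a X) < depth (X ⊴ a ⊵ Y)
  depth-H< X a Y = s≤s (ℕ.≤-trans (depth-H a X) (ℕ.m≤m⊔n (depth X) (depth Y)))

  depth-J< : ∀ X a Y → depth (J a Y) < depth (X ⊴ a ⊵ Y)
  depth-J< X a Y = s≤s (ℕ.≤-trans (depth-J a Y) (ℕ.m≤n⊔m (depth X) (depth Y)))

  crAcc : ∀ X → Acc _<_ (depth X) → Tree A
  crAcc T           _        = T
  crAcc F           _        = F
  crAcc (X ⊴ a ⊵ Y) (acc rs) =
    crAcc (H a X) (rs (depth-H< X a Y)) ⊴ a ⊵ crAcc (J a Y) (rs (depth-J< X a Y))

  cr : Tree A → Tree A
  cr X = crAcc X (<-wellFounded (depth X))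

  crAcc-irrelevant : ∀ X (p q : Acc _<_ (depth X)) → crAcc X p ≡ crAcc X q
  crAcc-irrelevant T           _        _        = refl
  crAcc-irrelevant F           _        _        = refl
  crAcc-irrelevant (X ⊴ a ⊵ Y) (acc rs) (acc ss) =
    cong₂ (_⊴ a ⊵_)
      (crAcc-irrelevant (H a X) (rs (depth-H< X a Y)) (ss (depth-H< X a Y)))
      (crAcc-irrelevant (J a Y) (rs (depth-J< X a Y)) (ss (depth-J< X a Y)))

  crAcc-⊴⊵ : ∀ X a Y (p : Acc _<_ (depth (X ⊴ a ⊵ Y))) →
             crAcc (X ⊴ a ⊵ Y) p ≡ cr (H a X) ⊴ a ⊵ cr (J a Y)
  crAcc-⊴⊵ X a Y (acc rs) = cong₂ (_⊴ a ⊵_)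
    (crAcc-irrelevant (H a X) (rs (depth-H< X a Y)) (<-wellFounded _))
    (crAcc-irrelevant (J a Y) (rs (depth-J< X a Y)) (<-wellFounded _))

  -- The recursion equation of cr (those for T and F hold by refl).
  cr-⊴⊵ : ∀ X a Y → cr (X ⊴ a ⊵ Y) ≡ cr (H a X) ⊴ a ⊵ cr (J a Y)
  cr-⊴⊵ X a Y = crAcc-⊴⊵ X a Y (<-wellFounded _)

  cse : C A → Tree A
  cse P = cr (se P)

  infix 4 _=cse_

  _=cse_ : Rel (C A) ℓ
  P =cse Q = cse P ≡ cse Q

{-# OPTIONS --safe #-}

-- Both directions factor through a structurally recursive form of cr that
-- carries the last evaluated atom with its value as a context. For soundness,
-- trees whose normal forms agree in every context form a model of CPcr: leaf
-- replacement respects this relation because normalising the condition first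
-- does not affect the context in which a replaced leaf is normalised.
-- For completeness, trees embed into terms as basic forms, every closed term is
-- provably equal to the basic form of its se-image, and each step of cr on basic
-- forms is an instance of CPcr1 or CPcr2.
module Submission where

open import Defs
open import Data.Bool using (Bool; true; false)
open import Data.Maybe using (Maybe; just; nothing)
open import Data.Nat using (ℕ)
open import Data.Product using (∃₂; _×_; _,_)
open import Function.Base using (_∘_)
open import Function.Bundles using (_↣_; _⇔_; mk⇔)
open import Level using (Level)
open import Relation.Binary.Bundles using (Setoid)
open import Relation.Binary.Core using (Rel)
open import Relation.Binary.PropositionalEquality
  using (_≡_; _≢_; refl; sym; trans; cong; cong₂)
import Relation.Binary.Reasoning.Setoid as SetoidReasoning
open import Relation.Nullary using (yes; no; contradiction)

private
  variable
    ℓ : Level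
    A : Set ℓ
    V W : Set

-- Leaf replacement and the algebra of trees

[T↦T,F↦F]-identity : (X : Tree A) → X [T↦ T ,F↦ F ] ≡ X
[T↦T,F↦F]-identity T           = refl
[T↦T,F↦F]-identity F           = refl
[T↦T,F↦F]-identity (X ⊴ a ⊵ Y) =
  cong₂ (_⊴ a ⊵_) ([T↦T,F↦F]-identity X) ([T↦T,F↦F]-identity Y)

[T↦,F↦]-assoc : (X Y₁ Y₂ Z₁ Z₂ : Tree A) →
  (X [T↦ Y₁ ,F↦ Y₂ ]) [T↦ Z₁ ,F↦ Z₂ ] ≡
  X [T↦ Y₁ [T↦ Z₁ ,F↦ Z₂ ] ,F↦ Y₂ [T↦ Z₁ ,F↦ Z₂ ] ]
[T↦,F↦]-assoc T             Y₁ Y₂ Z₁ Z₂ = refl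
[T↦,F↦]-assoc F             Y₁ Y₂ Z₁ Z₂ = refl
[T↦,F↦]-assoc (X₁ ⊴ a ⊵ X₂) Y₁ Y₂ Z₁ Z₂ =
  cong₂ (_⊴ a ⊵_) ([T↦,F↦]-assoc X₁ Y₁ Y₂ Z₁ Z₂) ([T↦,F↦]-assoc X₂ Y₁ Y₂ Z₁ Z₂)

[T↦,F↦]-cong : {X X′ Y Y′ Z Z′ : Tree A} → X ≡ X′ → Y ≡ Y′ → Z ≡ Z′ →
  X [T↦ Y ,F↦ Z ] ≡ X′ [T↦ Y′ ,F↦ Z′ ]
[T↦,F↦]-cong refl refl refl = refl

-- Open terms need a meaning too, since a derivation between closed terms may pass through open
-- ones.
eval : (V → Tree A) → Term A V → Tree A
eval ρ (var x)     = ρ x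
eval ρ T           = T
eval ρ F           = F
eval ρ (atom a)    = T ⊴ a ⊵ F
eval ρ (s ◁ t ▷ r) = eval ρ t [T↦ eval ρ s ,F↦ eval ρ r ]

eval-sub : (ρ : W → Tree A) (σ : V → Term A W) (t : Term A V) →
           eval ρ (sub σ t) ≡ eval (eval ρ ∘ σ) t
eval-sub ρ σ (var x)     = refl
eval-sub ρ σ T           = refl
eval-sub ρ σ F           = refl
eval-sub ρ σ (atom a)    = refl
eval-sub ρ σ (s ◁ t ▷ r) =
  [T↦,F↦]-cong (eval-sub ρ σ t) (eval-sub ρ σ s) (eval-sub ρ σ r)

eval-⌜⌝ : (ρ : Var → Tree A) (P : C A) → eval ρ ⌜ P ⌝ ≡ se P
eval-⌜⌝ ρ T           = refl
eval-⌜⌝ ρ F           = refl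
eval-⌜⌝ ρ (atom a)    = refl
eval-⌜⌝ ρ (P ◁ Q ▷ R) =
  [T↦,F↦]-cong (eval-⌜⌝ ρ Q) (eval-⌜⌝ ρ P) (eval-⌜⌝ ρ R)

-- Normalisation in a context and soundness

module Normalisation {A : Set ℓ} (A↣ℕ : A ↣ ℕ) where
  open Contractive A↣ℕ

  Context : Set ℓ
  Context = Maybe (A × Bool)

  known : Context → A → Maybe Bool
  known nothing        a = nothing
  known (just (b , v)) a with a ≟ b
  ... | yes _ = just v
  ... | no  _ = nothing

  known-self : ∀ a v → known (just (a , v)) a ≡ just v
  known-self a v with a ≟ a
  ... | yes _  = refl
  ... | no a≢a = contradiction refl a≢a

  normalise : Context → Tree A → Tree A
  normalise c T           = T
  normalise c F           = F
  normalise c (X ⊴ a ⊵ Y) with known c a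
  ... | just true  = normalise c X
  ... | just false = normalise c Y
  ... | nothing    = normalise (just (a , true)) X ⊴ a ⊵ normalise (just (a , false)) Y

  -- `H a` and `J a` strip the same initial run of `a`-nodes that `normalise` skips when `a` is
  -- known. At the first other atom the context holds no information, so `normalise` continues as
  -- from `nothing`.
  cr-⊴⊵≡normalise : ∀ X a Y → cr (X ⊴ a ⊵ Y) ≡ normalise nothing (X ⊴ a ⊵ Y)
  cr-H≡normalise  : ∀ a X → cr (H a X) ≡ normalise (just (a , true)) X
  cr-J≡normalise  : ∀ a X → cr (J a X) ≡ normalise (just (a , false)) X

  cr-⊴⊵≡normalise X a Y =
    trans (cr-⊴⊵ X a Y) (cong₂ (_⊴ a ⊵_) (cr-H≡normalise a X) (cr-J≡normalise a Y))

  cr-H≡normalise a T           = refl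
  cr-H≡normalise a F           = refl
  cr-H≡normalise a (X ⊴ b ⊵ Y) with b ≟ a
  ... | yes _ = cr-H≡normalise a X
  ... | no  _ = cr-⊴⊵≡normalise X b Y

  cr-J≡normalise a T           = refl
  cr-J≡normalise a F           = refl
  cr-J≡normalise a (X ⊴ b ⊵ Y) with b ≟ a
  ... | yes _ = cr-J≡normalise a Y
  ... | no  _ = cr-⊴⊵≡normalise X b Y

  cr≡normalise : ∀ X → cr X ≡ normalise nothing X
  cr≡normalise T           = refl
  cr≡normalise F           = refl
  cr≡normalise (X ⊴ a ⊵ Y) = cr-⊴⊵≡normalise X a Y

  infix 4 _≋_

  -- Quantifying over contexts lets inductions pass below a node, where the context changes.
  _≋_ : Rel (Tree A) ℓ
  X ≋ Y = ∀ c → normalise c X ≡ normalise c Y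

  ≡⇒≋ : ∀ {X Y} → X ≡ Y → X ≋ Y
  ≡⇒≋ X≡Y c = cong (normalise c) X≡Y

  -- The nodes deleted from `X` are exactly those that leave the context unchanged, so each leaf is
  -- still reached in the same context.
  normalise-condition : ∀ c X {Y Z} →
    normalise c (normalise c X [T↦ Y ,F↦ Z ]) ≡ normalise c (X [T↦ Y ,F↦ Z ])
  normalise-condition c T             = refl
  normalise-condition c F             = refl
  normalise-condition c (X₁ ⊴ a ⊵ X₂) with known c a in eq
  ... | just true  = normalise-condition c X₁
  ... | just false = normalise-condition c X₂
  -- The outer pass meets the surviving node in the same context `c`, hence keeps it as well.
  ... | nothing rewrite eq =
    cong₂ (_⊴ a ⊵_) (normalise-condition _ X₁) (normalise-condition _ X₂)

  [T↦,F↦]-≋-leaves : ∀ X {Y Y′ Z Z′} → Y ≋ Y′ → Z ≋ Z′ →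
                     X [T↦ Y ,F↦ Z ] ≋ X [T↦ Y′ ,F↦ Z′ ]
  [T↦,F↦]-≋-leaves T             Y≋Y′ Z≋Z′ c = Y≋Y′ c
  [T↦,F↦]-≋-leaves F             Y≋Y′ Z≋Z′ c = Z≋Z′ c
  [T↦,F↦]-≋-leaves (X₁ ⊴ a ⊵ X₂) Y≋Y′ Z≋Z′ c with known c a
  ... | just true  = [T↦,F↦]-≋-leaves X₁ Y≋Y′ Z≋Z′ c
  ... | just false = [T↦,F↦]-≋-leaves X₂ Y≋Y′ Z≋Z′ c
  ... | nothing    = cong₂ (_⊴ a ⊵_)
    ([T↦,F↦]-≋-leaves X₁ Y≋Y′ Z≋Z′ _) ([T↦,F↦]-≋-leaves X₂ Y≋Y′ Z≋Z′ _)

  -- Normalising the condition in `c` itself turns the hypothesis into an equality of trees.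
  [T↦,F↦]-≋-condition : ∀ X X′ {Y Z} → X ≋ X′ →
                        X [T↦ Y ,F↦ Z ] ≋ X′ [T↦ Y ,F↦ Z ]
  [T↦,F↦]-≋-condition X X′ {Y} {Z} X≋X′ c =
    trans (sym (normalise-condition c X))
      (trans (cong (λ U → normalise c (U [T↦ Y ,F↦ Z ])) (X≋X′ c))
        (normalise-condition c X′))

  -- Once the outer `a` is true, whether by `c` or by branching on it, the inner `a` is known and
  -- deleted; if `c` makes it false, both sides continue with `Z`.
  contract-left : ∀ a X Y Z → (X ⊴ a ⊵ Y) ⊴ a ⊵ Z ≋ X ⊴ a ⊵ Z
  contract-left a X Y Z c with known c a in eq
  ... | just true  rewrite eq                = refl
  ... | just false                           = refl
  ... | nothing    rewrite known-self a true = refl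

  contract-right : ∀ a X Y Z → X ⊴ a ⊵ (Y ⊴ a ⊵ Z) ≋ X ⊴ a ⊵ Z
  contract-right a X Y Z c with known c a in eq
  ... | just true                             = refl
  ... | just false rewrite eq                 = refl
  ... | nothing    rewrite known-self a false = refl

  eval-CPcr : ∀ {s t} → CPcr s t → (ρ : Var → Tree A) → eval ρ s ≋ eval ρ t
  eval-CPcr (cp CP1)  ρ c = refl
  eval-CPcr (cp CP2)  ρ c = refl
  eval-CPcr (cp CP3)  ρ = ≡⇒≋ ([T↦T,F↦F]-identity (ρ 0))
  eval-CPcr (cp CP4)  ρ = ≡⇒≋ ([T↦,F↦]-assoc (ρ 2) _ _ _ _)
  eval-CPcr (CPcr1 a) ρ = contract-left a (ρ 0) (ρ 1) (ρ 2)
  eval-CPcr (CPcr2 a) ρ = contract-right a (ρ 0) (ρ 1) (ρ 2)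

  -- All valuations are treated at once because the substitution rule replaces `ρ` by `eval ρ ∘ σ`.
  eval-⊢ : ∀ {s t} → CPcr ⊢ s ≈ t → (ρ : Var → Tree A) → eval ρ s ≋ eval ρ t
  eval-⊢ (axiom e)          ρ c = eval-CPcr e ρ c
  eval-⊢ reflexivity        ρ c = refl
  eval-⊢ (symmetry p)       ρ c = sym (eval-⊢ p ρ c)
  eval-⊢ (transitivity p q) ρ c = trans (eval-⊢ p ρ c) (eval-⊢ q ρ c)
  eval-⊢ (congruence {t = t} {t′} p q r) ρ c =
    trans ([T↦,F↦]-≋-condition (eval ρ t) (eval ρ t′) (eval-⊢ q ρ) c)
      ([T↦,F↦]-≋-leaves (eval ρ t′) (eval-⊢ p ρ) (eval-⊢ r ρ) c)
  eval-⊢ (substitution {s} {t} σ p) ρ c =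
    trans (≡⇒≋ (eval-sub ρ σ s) c)
      (trans (eval-⊢ p (eval ρ ∘ σ) c) (sym (≡⇒≋ (eval-sub ρ σ t) c)))

  soundness : ∀ P Q → CPcr ⊢ ⌜ P ⌝ ≈ ⌜ Q ⌝ → P =cse Q
  soundness P Q p = trans (toNormal P) (trans (eval-⊢ p ρ nothing) (sym (toNormal Q)))
    where
    ρ : Var → Tree A
    -- An arbitrary choice: closed terms do not depend on the valuation.
    ρ _ = T

    toNormal : ∀ R → cse R ≡ normalise nothing (eval ρ ⌜ R ⌝)
    toNormal R = trans (cr≡normalise (se R)) (sym (≡⇒≋ (eval-⌜⌝ ρ R) nothing))

-- Trees as basic forms

module BasicForms {A : Set ℓ} where

  ⊢-setoid : Setoid ℓ ℓ
  ⊢-setoid = record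
    { Carrier       = Term A Var
    ; _≈_           = CPcr ⊢_≈_
    ; isEquivalence = record
      { refl = reflexivity ; sym = symmetry ; trans = transitivity }
    }

  open SetoidReasoning ⊢-setoid public

  private
    -- Instantiates the axiom variables by position; below, trailing `T`s fill positions absent from
    -- the axiom at hand.
    env : (x y z u v : Term A Var) → Var → Term A Var
    env x y z u v 0 = x
    env x y z u v 1 = y
    env x y z u v 2 = z
    env x y z u v 3 = u
    env x y z u v _ = v

  ◁T▷ : ∀ x y → CPcr ⊢ x ◁ T ▷ y ≈ x
  ◁T▷ x y = substitution (env x y T T T) (axiom (cp CP1))

  ◁F▷ : ∀ x y → CPcr ⊢ x ◁ F ▷ y ≈ y
  ◁F▷ x y = substitution (env x y T T T) (axiom (cp CP2))

  T◁▷F : ∀ x → CPcr ⊢ T ◁ x ▷ F ≈ x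
  T◁▷F x = substitution (env x T T T T) (axiom (cp CP3))

  ◁▷-distrib : ∀ x y z u v →
    CPcr ⊢ x ◁ (y ◁ z ▷ u) ▷ v ≈ (x ◁ y ▷ v) ◁ z ▷ (x ◁ u ▷ v)
  ◁▷-distrib x y z u v = substitution (env x y z u v) (axiom (cp CP4))

  ◁▷-contract-left : ∀ a x y z →
    CPcr ⊢ (x ◁ atom a ▷ y) ◁ atom a ▷ z ≈ x ◁ atom a ▷ z
  ◁▷-contract-left a x y z = substitution (env x y z T T) (axiom (CPcr1 a))

  ◁▷-contract-right : ∀ a x y z →
    CPcr ⊢ x ◁ atom a ▷ (y ◁ atom a ▷ z) ≈ x ◁ atom a ▷ z
  ◁▷-contract-right a x y z = substitution (env x y z T T) (axiom (CPcr2 a))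

  term : Tree A → Term A Var
  term T           = T
  term F           = F
  term (X ⊴ a ⊵ Y) = term X ◁ atom a ▷ term Y

  -- CP4 moves the replacement below each node, and CP1 and CP2 carry it out at the leaves.
  term-[T↦,F↦] : ∀ X Y Z →
    CPcr ⊢ term Y ◁ term X ▷ term Z ≈ term (X [T↦ Y ,F↦ Z ])
  term-[T↦,F↦] T             Y Z = ◁T▷ (term Y) (term Z)
  term-[T↦,F↦] F             Y Z = ◁F▷ (term Y) (term Z)
  term-[T↦,F↦] (X₁ ⊴ a ⊵ X₂) Y Z = transitivity
    (◁▷-distrib (term Y) (term X₁) (atom a) (term X₂) (term Z))
    (congruence (term-[T↦,F↦] X₁ Y Z) reflexivity (term-[T↦,F↦] X₂ Y Z))

  term-se : ∀ P → CPcr ⊢ ⌜ P ⌝ ≈ term (se P)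
  term-se T           = reflexivity
  term-se F           = reflexivity
  term-se (atom a)    = symmetry (T◁▷F (atom a))
  term-se (P ◁ Q ▷ R) = transitivity
    (congruence (term-se P) (term-se Q) (term-se R))
    (term-[T↦,F↦] (se Q) (se P) (se R))

-- Derivability of normal forms and completeness

module Completeness {A : Set ℓ} (A↣ℕ : A ↣ ℕ) where
  open Contractive A↣ℕ
  open Normalisation A↣ℕ
  open BasicForms {A = A}

  -- A repeated `a` can be contracted only under the enclosing test of `a`, so the branch lemmas
  -- keep that test. Their other branch `z` is arbitrary, so that the two sides can be normalised
  -- one after the other.
  term-normalise-⊴⊵    : ∀ X a Y →
    CPcr ⊢ term (X ⊴ a ⊵ Y) ≈ term (normalise nothing (X ⊴ a ⊵ Y))
  term-normalise-left  : ∀ a X z →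
    CPcr ⊢ term X ◁ atom a ▷ z ≈ term (normalise (just (a , true)) X) ◁ atom a ▷ z
  term-normalise-right : ∀ a X z →
    CPcr ⊢ z ◁ atom a ▷ term X ≈ z ◁ atom a ▷ term (normalise (just (a , false)) X)

  term-normalise-⊴⊵ X a Y = transitivity
    (term-normalise-left a X (term Y)) (term-normalise-right a Y _)

  term-normalise-left a T           z = reflexivity
  term-normalise-left a F           z = reflexivity
  term-normalise-left a (X ⊴ b ⊵ Y) z with b ≟ a
  ... | yes refl = transitivity
    (◁▷-contract-left a (term X) (term Y) z) (term-normalise-left a X z)
  ... | no _     = congruence (term-normalise-⊴⊵ X b Y) reflexivity reflexivity

  term-normalise-right a T           z = reflexivity
  term-normalise-right a F           z = reflexivity
  term-normalise-right a (X ⊴ b ⊵ Y) z with b ≟ a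
  ... | yes refl = transitivity
    (◁▷-contract-right a z (term X) (term Y)) (term-normalise-right a Y z)
  ... | no _     = congruence reflexivity reflexivity (term-normalise-⊴⊵ X b Y)

  term-normalise : ∀ X → CPcr ⊢ term X ≈ term (normalise nothing X)
  term-normalise T           = reflexivity
  term-normalise F           = reflexivity
  term-normalise (X ⊴ a ⊵ Y) = term-normalise-⊴⊵ X a Y

  term-cse : ∀ P → CPcr ⊢ ⌜ P ⌝ ≈ term (cse P)
  term-cse P = begin
    ⌜ P ⌝                           ≈⟨ term-se P ⟩
    term (se P)                     ≈⟨ term-normalise (se P) ⟩
    term (normalise nothing (se P)) ≡⟨ cong term (cr≡normalise (se P)) ⟨
    term (cse P)                    ∎

  completeness : ∀ P Q → P =cse Q → CPcr ⊢ ⌜ P ⌝ ≈ ⌜ Q ⌝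
  completeness P Q eq = begin
    ⌜ P ⌝        ≈⟨ term-cse P ⟩
    term (cse P) ≡⟨ cong term eq ⟩
    term (cse Q) ≈⟨ term-cse Q ⟨
    ⌜ Q ⌝        ∎

theorem4p15 : {ℓ : Level} (A : Set ℓ) (A↣ℕ : A ↣ ℕ) → (∃₂ λ (a b : A) → a ≢ b) →
    let open Contractive A↣ℕ using (_=cse_) in
    (P Q : C A) → (CPcr ⊢ ⌜ P ⌝ ≈ ⌜ Q ⌝) ⇔ (P =cse Q)
theorem4p15 A A↣ℕ _ P Q =
  mk⇔ (Normalisation.soundness A↣ℕ P Q) (Completeness.completeness A↣ℕ P Q)
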